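{- For $R=\mathbb{Z}_{25}$ and for $R=\mathbb{S}_5=\mathbb{F}_5[X]/(X^2)$ there exist projective arcs with parameters $(355,15)$, $(375,16)$ and $(395,17)$ in $\mathrm{PHG}(2,R)$.
   Context: For a finite chain ring $R$ of length $2$ with residue field $\mathbb{F}_q$, the projective Hjelmslev plane $\mathrm{PHG}(2,R)$ is the incidence structure whose points are the free rank-$1$ submodules of the right module $R_R^3$, whose lines are the free rank-$2$ submodules of $R_R^3$, with incidence given by inclusion. A projective $(k,n)$-arc is a set of $k$ points meeting every line in at most $n$ points. -}

module Defs where

open import Algebra.Bundles using (AbelianGroup; CommutativeMonoid; CommutativeRing; Ring)
open import Algebra.Module.Bundles using (RightModule)
open import Algebra.Structures using (IsAbelianGroup; IsCommutativeRing)
open import Data.Fin.Base using (Fin)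
open import Data.Fin.Subset using (Subset; _∈_; ∣_∣)
open import Data.List.Base using (List; []; _∷_; map)
open import Data.Nat.Base using (ℕ; zero; suc; _≤_)
open import Data.Product.Base using (∃-syntax; _,_)
open import Data.Vec.Functional using (Vector)
open import Function.Definitions using (Injective)
open import Level using (Level; 0ℓ; _⊔_) renaming (suc to lsuc)
open import Relation.Binary.Core using (Rel)
open import Relation.Binary.Definitions using (_Respects_)
open import Relation.Binary.PropositionalEquality.Core using (_≡_)
open import Relation.Binary.Structures using (IsEquivalence)
open import Relation.Unary using (Pred; _⊆_; _≐_)
import Algebra.Construct.Pointwise as Pointwise
import Algebra.Definitions.RawMagma as Divisibility
import Algebra.Properties.CommutativeMonoid.Sum as Sum
import Algebra.Properties.CommutativeSemigroup as CommutativeSemigroupProperties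
import Algebra.Properties.Ring as RingProperties
import Data.Integer.Base as ℤ
import Data.Integer.Properties as ℤ
import Relation.Binary.Reasoning.Setoid as ≈-Reasoning

module _ {c ℓ : Level} (R : CommutativeRing c ℓ) (a : CommutativeRing.Carrier R) where
  open CommutativeRing R
  open Divisibility *-rawMagma using (_∣_) renaming (_,_ to _,ᵈ_)

  -- Congruence modulo the principal ideal (a).  A record, so that x and y
  -- can be recovered from the type of a proof.
  record CongruentMod (x y : Carrier) : Set (c ⊔ ℓ) where
    constructor congruent
    field a∣x-y : a ∣ (x - y)

  private
    open ≈-Reasoning setoid
    open RingProperties ring using (-‿distribˡ-*; -‿+-comm)
    open CommutativeSemigroupProperties +-commutativeSemigroup using (interchange)

    fromSum : ∀ {x y} r → x ≈ y + r * a → CongruentMod x y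
    fromSum {x} {y} r eq = congruent (r ,ᵈ (begin
      r * a                 ≈⟨ +-identityʳ _ ⟨
      r * a + 0#            ≈⟨ +-congˡ (-‿inverseʳ y) ⟨
      r * a + (y - y)       ≈⟨ +-assoc _ _ _ ⟨
      r * a + y - y         ≈⟨ +-congʳ (+-comm _ _) ⟩
      y + r * a - y         ≈⟨ +-congʳ eq ⟨
      x - y                 ∎))

    toSum : ∀ {x y} → CongruentMod x y → ∃[ r ] (x ≈ y + r * a)
    toSum {x} {y} (congruent (r ,ᵈ eq)) = r , (begin
      x                     ≈⟨ +-identityʳ x ⟨
      x + 0#                ≈⟨ +-congˡ (-‿inverseˡ y) ⟨
      x + (- y + y)         ≈⟨ +-assoc _ _ _ ⟨
      x - y + y             ≈⟨ +-comm _ _ ⟩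
      y + (x - y)           ≈⟨ +-congˡ eq ⟨
      y + r * a             ∎)

    lift : ∀ {x y} → x ≈ y → CongruentMod x y
    lift {x} {y} eq = fromSum 0# (begin
      x                     ≈⟨ eq ⟩
      y                     ≈⟨ +-identityʳ y ⟨
      y + 0#                ≈⟨ +-congˡ (zeroˡ a) ⟨
      y + 0# * a            ∎)

    ∼-sym : ∀ {x y} → CongruentMod x y → CongruentMod y x
    ∼-sym {x} {y} p with r , eq ← toSum p = fromSum (- r) (begin
      y                           ≈⟨ +-identityʳ y ⟨
      y + 0#                      ≈⟨ +-congˡ (-‿inverseʳ _) ⟨
      y + (r * a - r * a)         ≈⟨ +-assoc _ _ _ ⟨
      y + r * a - r * a           ≈⟨ +-cong (sym eq) (-‿distribˡ-* r a) ⟩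
      x + - r * a                 ∎)

    ∼-trans : ∀ {x y z} → CongruentMod x y → CongruentMod y z → CongruentMod x z
    ∼-trans {x} {y} {z} p q with r , eq ← toSum p | s , eq′ ← toSum q = fromSum (s + r) (begin
      x                           ≈⟨ eq ⟩
      y + r * a                   ≈⟨ +-congʳ eq′ ⟩
      z + s * a + r * a           ≈⟨ +-assoc _ _ _ ⟩
      z + (s * a + r * a)         ≈⟨ +-congˡ (distribʳ a s r) ⟨
      z + (s + r) * a             ∎)

    ∼-+-cong : ∀ {x x′ y y′} → CongruentMod x x′ → CongruentMod y y′ → CongruentMod (x + y) (x′ + y′)
    ∼-+-cong {x} {x′} {y} {y′} p q with r , eq ← toSum p | s , eq′ ← toSum q = fromSum (r + s) (begin
      x + y                       ≈⟨ +-cong eq eq′ ⟩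
      (x′ + r * a) + (y′ + s * a) ≈⟨ interchange _ _ _ _ ⟩
      (x′ + y′) + (r * a + s * a) ≈⟨ +-congˡ (distribʳ a r s) ⟨
      (x′ + y′) + (r + s) * a     ∎)

    ∼-neg-cong : ∀ {x y} → CongruentMod x y → CongruentMod (- x) (- y)
    ∼-neg-cong {x} {y} p with r , eq ← toSum p = fromSum (- r) (begin
      - x                         ≈⟨ -‿cong eq ⟩
      - (y + r * a)               ≈⟨ -‿+-comm y (r * a) ⟨
      - y - r * a                 ≈⟨ +-congˡ (-‿distribˡ-* r a) ⟩
      - y + - r * a               ∎)

    ∼-*-congʳ : ∀ {x x′} y → CongruentMod x x′ → CongruentMod (x * y) (x′ * y)
    ∼-*-congʳ {x} {x′} y p with r , eq ← toSum p = fromSum (y * r) (begin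
      x * y                       ≈⟨ *-congʳ eq ⟩
      (x′ + r * a) * y            ≈⟨ distribʳ y x′ (r * a) ⟩
      x′ * y + r * a * y          ≈⟨ +-congˡ (*-comm _ y) ⟩
      x′ * y + y * (r * a)        ≈⟨ +-congˡ (*-assoc y r a) ⟨
      x′ * y + y * r * a          ∎)

    ∼-*-cong : ∀ {x x′ y y′} → CongruentMod x x′ → CongruentMod y y′ → CongruentMod (x * y) (x′ * y′)
    ∼-*-cong {x} {x′} {y} {y′} p q =
      ∼-trans (∼-*-congʳ y p)
        (∼-trans (lift (*-comm x′ y)) (∼-trans (∼-*-congʳ x′ q) (lift (*-comm y′ x′))))

    ∼-isCommutativeRing : IsCommutativeRing CongruentMod _+_ _*_ -_ 0# 1#
    ∼-isCommutativeRing = record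
      { isRing = record
        { +-isAbelianGroup = record
          { isGroup = record
            { isMonoid = record
              { isSemigroup = record
                { isMagma = record
                  { isEquivalence = record { refl = lift refl ; sym = ∼-sym ; trans = ∼-trans }
                  ; ∙-cong = ∼-+-cong
                  }
                ; assoc = λ x y z → lift (+-assoc x y z)
                }
              ; identity = (λ x → lift (+-identityˡ x)) , (λ x → lift (+-identityʳ x))
              }
            ; inverse = (λ x → lift (-‿inverseˡ x)) , (λ x → lift (-‿inverseʳ x))
            ; ⁻¹-cong = ∼-neg-cong
            }
          ; comm = λ x y → lift (+-comm x y)
          }
        ; *-cong = ∼-*-cong
        ; *-assoc = λ x y z → lift (*-assoc x y z)
        ; *-identity = (λ x → lift (*-identityˡ x)) , (λ x → lift (*-identityʳ x))
        ; distrib = (λ x y z → lift (distribˡ x y z)) , (λ x y z → lift (distribʳ x y z))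
        }
      ; *-comm = λ x y → lift (*-comm x y)
      }

  _/⟨_⟩ : CommutativeRing c (c ⊔ ℓ)
  _/⟨_⟩ = record { isCommutativeRing = ∼-isCommutativeRing }

module Polynomial {c ℓ : Level} (R : CommutativeRing c ℓ) where
  open CommutativeRing R

  -- Coefficients in order of increasing degree; trailing zeros are allowed
  -- and are identified away by _≋_.
  Poly : Set c
  Poly = List Carrier

  coeff : Poly → ℕ → Carrier
  coeff []      _       = 0#
  coeff (a ∷ p) zero    = a
  coeff (a ∷ p) (suc n) = coeff p n

  infix 4 _≋_
  record _≋_ (p q : Poly) : Set ℓ where
    constructor coeffwise
    field coeff-≈ : ∀ n → coeff p n ≈ coeff q n
  open _≋_ public

  infixl 6 _⊕_
  infixl 7 _⊛_ _·_

  _⊕_ : Poly → Poly → Poly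
  []      ⊕ q       = q
  (a ∷ p) ⊕ []      = a ∷ p
  (a ∷ p) ⊕ (b ∷ q) = a + b ∷ p ⊕ q

  ⊖_ : Poly → Poly
  ⊖_ = map (-_)

  _·_ : Carrier → Poly → Poly
  a · p = map (a *_) p

  _⊛_ : Poly → Poly → Poly
  []      ⊛ q = []
  (a ∷ p) ⊛ q = a · q ⊕ (0# ∷ p ⊛ q)

  𝟙 : Poly
  𝟙 = 1# ∷ []

  X : Poly
  X = 0# ∷ 1# ∷ []

  coeff-⊕ : ∀ p q n → coeff (p ⊕ q) n ≈ coeff p n + coeff q n
  coeff-⊕ []      q       n       = sym (+-identityˡ _)
  coeff-⊕ (a ∷ p) []      n       = sym (+-identityʳ _)
  coeff-⊕ (a ∷ p) (b ∷ q) zero    = refl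
  coeff-⊕ (a ∷ p) (b ∷ q) (suc n) = coeff-⊕ p q n

  coeff-⊖ : ∀ p n → coeff (⊖ p) n ≈ - coeff p n
  coeff-⊖ []      n       = sym (RingProperties.-0#≈0# ring)
  coeff-⊖ (a ∷ p) zero    = refl
  coeff-⊖ (a ∷ p) (suc n) = coeff-⊖ p n

  coeff-· : ∀ a p n → coeff (a · p) n ≈ a * coeff p n
  coeff-· a []      n       = sym (zeroʳ a)
  coeff-· a (b ∷ p) zero    = refl
  coeff-· a (b ∷ p) (suc n) = coeff-· a p n

  private
    ≋-refl : ∀ {p} → p ≋ p
    ≋-refl = coeffwise λ n → refl

    ≋-sym : ∀ {p q} → p ≋ q → q ≋ p
    ≋-sym e = coeffwise λ n → sym (coeff-≈ e n)

    ≋-trans : ∀ {p q r} → p ≋ q → q ≋ r → p ≋ r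
    ≋-trans e f = coeffwise λ n → trans (coeff-≈ e n) (coeff-≈ f n)

    ∷-cong : ∀ {a b p q} → a ≈ b → p ≋ q → a ∷ p ≋ b ∷ q
    ∷-cong e f = coeffwise λ where
      zero    → e
      (suc n) → coeff-≈ f n

    tail-≋ : ∀ {a b p q} → a ∷ p ≋ b ∷ q → p ≋ q
    tail-≋ e = coeffwise λ n → coeff-≈ e (suc n)

    tail-≋[] : ∀ {a p} → a ∷ p ≋ [] → p ≋ []
    tail-≋[] e = coeffwise λ n → coeff-≈ e (suc n)

    0∷[] : ∀ {p} → p ≋ [] → 0# ∷ p ≋ []
    0∷[] e = coeffwise λ where
      zero    → refl
      (suc n) → coeff-≈ e n

    ⊕-cong : ∀ {p p′ q q′} → p ≋ p′ → q ≋ q′ → p ⊕ q ≋ p′ ⊕ q′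
    ⊕-cong {p} {p′} {q} {q′} e f = coeffwise λ n →
      trans (coeff-⊕ p q n) (trans (+-cong (coeff-≈ e n) (coeff-≈ f n)) (sym (coeff-⊕ p′ q′ n)))

    ⊕-assoc : ∀ p q r → (p ⊕ q) ⊕ r ≋ p ⊕ (q ⊕ r)
    ⊕-assoc p q r = coeffwise λ n →
      trans (coeff-⊕ (p ⊕ q) r n) (trans (+-congʳ (coeff-⊕ p q n)) (trans (+-assoc _ _ _)
        (trans (+-congˡ (sym (coeff-⊕ q r n))) (sym (coeff-⊕ p (q ⊕ r) n)))))

    ⊕-comm : ∀ p q → p ⊕ q ≋ q ⊕ p
    ⊕-comm p q = coeffwise λ n →
      trans (coeff-⊕ p q n) (trans (+-comm _ _) (sym (coeff-⊕ q p n)))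

    ⊕-identityʳ : ∀ p → p ⊕ [] ≋ p
    ⊕-identityʳ p = ⊕-comm p []

    ⊖-cong : ∀ {p q} → p ≋ q → ⊖ p ≋ ⊖ q
    ⊖-cong {p} {q} e = coeffwise λ n →
      trans (coeff-⊖ p n) (trans (-‿cong (coeff-≈ e n)) (sym (coeff-⊖ q n)))

    ⊖-inverseʳ : ∀ p → p ⊕ (⊖ p) ≋ []
    ⊖-inverseʳ p = coeffwise λ n →
      trans (coeff-⊕ p (⊖ p) n) (trans (+-congˡ (coeff-⊖ p n)) (-‿inverseʳ _))

    ⊕-isAbelianGroup : IsAbelianGroup _≋_ _⊕_ [] ⊖_
    ⊕-isAbelianGroup = record
      { isGroup = record
        { isMonoid = record
          { isSemigroup = record
            { isMagma = record
              { isEquivalence = record { refl = ≋-refl ; sym = ≋-sym ; trans = ≋-trans }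
              ; ∙-cong = ⊕-cong
              }
            ; assoc = ⊕-assoc
            }
          ; identity = (λ p → ≋-refl) , ⊕-identityʳ
          }
        ; inverse = (λ p → ≋-trans (⊕-comm (⊖ p) p) (⊖-inverseʳ p)) , ⊖-inverseʳ
        ; ⁻¹-cong = ⊖-cong
        }
      ; comm = ⊕-comm
      }

    ⊕-abelianGroup : AbelianGroup c ℓ
    ⊕-abelianGroup = record { isAbelianGroup = ⊕-isAbelianGroup }

    open ≈-Reasoning (AbelianGroup.setoid ⊕-abelianGroup)
    open CommutativeSemigroupProperties
      (CommutativeMonoid.commutativeSemigroup (AbelianGroup.commutativeMonoid ⊕-abelianGroup))
      using (interchange; x∙yz≈y∙xz)

    ·-cong : ∀ {a b p q} → a ≈ b → p ≋ q → a · p ≋ b · q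
    ·-cong {a} {b} {p} {q} e f = coeffwise λ n →
      trans (coeff-· a p n) (trans (*-cong e (coeff-≈ f n)) (sym (coeff-· b q n)))

    ·-distribˡ : ∀ a p q → a · (p ⊕ q) ≋ a · p ⊕ a · q
    ·-distribˡ a p q = coeffwise λ n →
      trans (coeff-· a (p ⊕ q) n) (trans (*-congˡ (coeff-⊕ p q n)) (trans (distribˡ _ _ _)
        (trans (+-cong (sym (coeff-· a p n)) (sym (coeff-· a q n))) (sym (coeff-⊕ (a · p) (a · q) n)))))

    ·-distribʳ : ∀ a b p → (a + b) · p ≋ a · p ⊕ b · p
    ·-distribʳ a b p = coeffwise λ n →
      trans (coeff-· (a + b) p n) (trans (distribʳ _ _ _)
        (trans (+-cong (sym (coeff-· a p n)) (sym (coeff-· b p n))) (sym (coeff-⊕ (a · p) (b · p) n))))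

    ·-assoc : ∀ a b p → (a * b) · p ≋ a · (b · p)
    ·-assoc a b p = coeffwise λ n →
      trans (coeff-· (a * b) p n) (trans (*-assoc _ _ _)
        (trans (*-congˡ (sym (coeff-· b p n))) (sym (coeff-· a (b · p) n))))

    0· : ∀ p → 0# · p ≋ []
    0· p = coeffwise λ n → trans (coeff-· 0# p n) (zeroˡ _)

    1· : ∀ p → 1# · p ≋ p
    1· p = coeffwise λ n → trans (coeff-· 1# p n) (*-identityˡ _)

    ⊛-zeroʳ : ∀ p → p ⊛ [] ≋ []
    ⊛-zeroʳ []      = ≋-refl
    ⊛-zeroʳ (a ∷ p) = 0∷[] (⊛-zeroʳ p)

    ⊛-congˡ : ∀ p {q q′} → q ≋ q′ → p ⊛ q ≋ p ⊛ q′
    ⊛-congˡ []      e = ≋-refl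
    ⊛-congˡ (a ∷ p) e = ⊕-cong (·-cong refl e) (∷-cong refl (⊛-congˡ p e))

    ⊛-∷ʳ : ∀ p b q → p ⊛ (b ∷ q) ≋ b · p ⊕ (0# ∷ p ⊛ q)
    ⊛-∷ʳ []      b q = ≋-sym (0∷[] ≋-refl)
    ⊛-∷ʳ (a ∷ p) b q = ∷-cong (+-congʳ (*-comm a b)) (begin
      a · q ⊕ p ⊛ (b ∷ q)               ≈⟨ ⊕-cong ≋-refl (⊛-∷ʳ p b q) ⟩
      a · q ⊕ (b · p ⊕ (0# ∷ p ⊛ q))    ≈⟨ x∙yz≈y∙xz (a · q) (b · p) (0# ∷ p ⊛ q) ⟩
      b · p ⊕ (a · q ⊕ (0# ∷ p ⊛ q))    ∎)

    ⊛-comm : ∀ p q → p ⊛ q ≋ q ⊛ p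
    ⊛-comm []      q = ≋-sym (⊛-zeroʳ q)
    ⊛-comm (a ∷ p) q = begin
      a · q ⊕ (0# ∷ p ⊛ q)              ≈⟨ ⊕-cong ≋-refl (∷-cong refl (⊛-comm p q)) ⟩
      a · q ⊕ (0# ∷ q ⊛ p)              ≈⟨ ⊛-∷ʳ q a p ⟨
      q ⊛ (a ∷ p)                       ∎

    ⊛-cong : ∀ {p p′ q q′} → p ≋ p′ → q ≋ q′ → p ⊛ q ≋ p′ ⊛ q′
    ⊛-cong {p} {p′} {q} {q′} e f = begin
      p ⊛ q                             ≈⟨ ⊛-congˡ p f ⟩
      p ⊛ q′                            ≈⟨ ⊛-comm p q′ ⟩
      q′ ⊛ p                            ≈⟨ ⊛-congˡ q′ e ⟩
      q′ ⊛ p′                           ≈⟨ ⊛-comm q′ p′ ⟩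
      p′ ⊛ q′                           ∎

    ⊛-distribˡ : ∀ p q r → p ⊛ (q ⊕ r) ≋ p ⊛ q ⊕ p ⊛ r
    ⊛-distribˡ []      q r = ≋-refl
    ⊛-distribˡ (a ∷ p) q r = begin
      a · (q ⊕ r) ⊕ (0# ∷ p ⊛ (q ⊕ r))
        ≈⟨ ⊕-cong (·-distribˡ a q r) (∷-cong (sym (+-identityˡ 0#)) (⊛-distribˡ p q r)) ⟩
      (a · q ⊕ a · r) ⊕ ((0# ∷ p ⊛ q) ⊕ (0# ∷ p ⊛ r))
        ≈⟨ interchange (a · q) (a · r) (0# ∷ p ⊛ q) (0# ∷ p ⊛ r) ⟩
      (a · q ⊕ (0# ∷ p ⊛ q)) ⊕ (a · r ⊕ (0# ∷ p ⊛ r)) ∎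

    ⊛-distribʳ : ∀ p q r → (q ⊕ r) ⊛ p ≋ q ⊛ p ⊕ r ⊛ p
    ⊛-distribʳ p q r = begin
      (q ⊕ r) ⊛ p                       ≈⟨ ⊛-comm (q ⊕ r) p ⟩
      p ⊛ (q ⊕ r)                       ≈⟨ ⊛-distribˡ p q r ⟩
      p ⊛ q ⊕ p ⊛ r                     ≈⟨ ⊕-cong (⊛-comm p q) (⊛-comm p r) ⟩
      q ⊛ p ⊕ r ⊛ p                     ∎

    ·-⊛ : ∀ a p q → (a · p) ⊛ q ≋ a · (p ⊛ q)
    ·-⊛ a []      q = ≋-refl
    ·-⊛ a (b ∷ p) q = begin
      (a * b) · q ⊕ (0# ∷ (a · p) ⊛ q)
        ≈⟨ ⊕-cong (·-assoc a b q) (∷-cong (sym (zeroʳ a)) (·-⊛ a p q)) ⟩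
      a · (b · q) ⊕ a · (0# ∷ p ⊛ q)    ≈⟨ ·-distribˡ a (b · q) (0# ∷ p ⊛ q) ⟨
      a · (b · q ⊕ (0# ∷ p ⊛ q))        ∎

    0∷-⊛ : ∀ p q → (0# ∷ p) ⊛ q ≋ 0# ∷ p ⊛ q
    0∷-⊛ p q = ⊕-cong (0· q) ≋-refl

    ⊛-assoc : ∀ p q r → (p ⊛ q) ⊛ r ≋ p ⊛ (q ⊛ r)
    ⊛-assoc []      q r = ≋-refl
    ⊛-assoc (a ∷ p) q r = begin
      (a · q ⊕ (0# ∷ p ⊛ q)) ⊛ r        ≈⟨ ⊛-distribʳ r (a · q) (0# ∷ p ⊛ q) ⟩
      (a · q) ⊛ r ⊕ (0# ∷ p ⊛ q) ⊛ r    ≈⟨ ⊕-cong (·-⊛ a q r) (0∷-⊛ (p ⊛ q) r) ⟩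
      a · (q ⊛ r) ⊕ (0# ∷ (p ⊛ q) ⊛ r)  ≈⟨ ⊕-cong ≋-refl (∷-cong refl (⊛-assoc p q r)) ⟩
      a · (q ⊛ r) ⊕ (0# ∷ p ⊛ (q ⊛ r))  ∎

    ⊛-identityˡ : ∀ p → 𝟙 ⊛ p ≋ p
    ⊛-identityˡ p = begin
      1# · p ⊕ (0# ∷ [])                ≈⟨ ⊕-cong (1· p) (0∷[] ≋-refl) ⟩
      p ⊕ []                            ≈⟨ ⊕-identityʳ p ⟩
      p                                 ∎

  polynomialRing : CommutativeRing c ℓ
  polynomialRing = record
    { _≈_ = _≋_ ; _+_ = _⊕_ ; _*_ = _⊛_ ; -_ = ⊖_ ; 0# = [] ; 1# = 𝟙
    ; isCommutativeRing = record
      { isRing = record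
        { +-isAbelianGroup = ⊕-isAbelianGroup
        ; *-cong = ⊛-cong
        ; *-assoc = ⊛-assoc
        ; *-identity = ⊛-identityˡ , λ p → ≋-trans (⊛-comm p 𝟙) (⊛-identityˡ p)
        ; distrib = ⊛-distribˡ , ⊛-distribʳ
        }
      ; *-comm = ⊛-comm
      }
    }

module _ {r ℓr m ℓm : Level} {R : Ring r ℓr} (M : RightModule R m ℓm) where
  open Ring R using (Carrier; _≈_; 0#)
  open RightModule M

  record Submodule (p : Level) : Set (r ⊔ m ⊔ ℓm ⊔ lsuc p) where
    field
      member   : Pred Carrierᴹ p
      resp     : member Respects _≈ᴹ_
      0-closed : member 0ᴹ
      +-closed : ∀ {x y} → member x → member y → member (x +ᴹ y)
      *-closed : ∀ {x} → member x → (s : Carrier) → member (x *ᵣ s)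

  linearCombination : ∀ {k} → Vector Carrierᴹ k → Vector Carrier k → Carrierᴹ
  linearCombination b s = Sum.sum +ᴹ-commutativeMonoid (λ i → b i *ᵣ s i)

  record IsBasis {p k} (N : Submodule p) (b : Vector Carrierᴹ k) : Set (r ⊔ ℓr ⊔ m ⊔ ℓm ⊔ p) where
    open Submodule N
    field
      ∈-member    : ∀ i → member (b i)
      spanning    : ∀ {x} → member x → ∃[ s ] (x ≈ᴹ linearCombination b s)
      independent : ∀ s → linearCombination b s ≈ᴹ 0ᴹ → ∀ i → s i ≈ 0#

  record FreeSubmodule (p : Level) (k : ℕ) : Set (r ⊔ ℓr ⊔ m ⊔ ℓm ⊔ lsuc p) where
    field
      submodule : Submodule p
      basis     : Vector Carrierᴹ k
      isBasis   : IsBasis submodule basis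
    open Submodule submodule public

module _ {c ℓ : Level} (R : Ring c ℓ) where
  open Ring R

  freeRightModule : ℕ → RightModule R c ℓ
  freeRightModule n = record
    { Carrierᴹ = Vector Carrier n
    ; _*ᵣ_ = λ v s i → v i * s
    ; isRightModule = record
      { isRightSemimodule = record
        { +ᴹ-isCommutativeMonoid = AbelianGroup.isCommutativeMonoid group
        ; isPrerightSemimodule = record
          { *ᵣ-cong      = λ e f i → *-cong (e i) f
          ; *ᵣ-zeroʳ     = λ v i → zeroʳ (v i)
          ; *ᵣ-distribˡ  = λ v s t i → distribˡ (v i) s t
          ; *ᵣ-identityʳ = λ v i → *-identityʳ (v i)
          ; *ᵣ-assoc     = λ v s t i → *-assoc (v i) s t
          ; *ᵣ-zeroˡ     = λ s i → zeroˡ s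
          ; *ᵣ-distribʳ  = λ s v w i → distribʳ s (v i) (w i)
          }
        }
      ; -ᴹ‿cong = AbelianGroup.⁻¹-cong group
      ; -ᴹ‿inverse = AbelianGroup.inverse group
      }
    } where group = Pointwise.abelianGroup (Fin n) +-abelianGroup

record IncidenceStructure (p ℓ l i : Level) : Set (lsuc (p ⊔ ℓ ⊔ l ⊔ i)) where
  field
    Point         : Set p
    _≈ₚ_          : Rel Point ℓ
    isEquivalence : IsEquivalence _≈ₚ_
    Line          : Set l
    _I_           : Point → Line → Set i

-- PHG(2,R).  Submodules are predicates, so equality of points is mutual
-- inclusion; the chosen bases are irrelevant to it.
PHG₂ : ∀ {c ℓ} → Ring c ℓ → IncidenceStructure (lsuc (c ⊔ ℓ)) (c ⊔ ℓ) (lsuc (c ⊔ ℓ)) (c ⊔ ℓ)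
PHG₂ {c} {ℓ} R = record
  { Point         = FreeSubmodule R³ (c ⊔ ℓ) 1
  ; _≈ₚ_          = λ P Q → member P ≐ member Q
  ; isEquivalence = record
    { refl  = (λ x → x) , (λ x → x)
    ; sym   = λ (f , g) → g , f
    ; trans = λ (f , g) (h , k) → (λ x → h (f x)) , (λ x → g (k x))
    }
  ; Line          = FreeSubmodule R³ (c ⊔ ℓ) 2
  ; _I_           = λ P L → member P ⊆ member L
  }
  where
  R³ = freeRightModule R 3
  open FreeSubmodule

-- A projective (k,n)-arc: a set of k points, enumerated without repetition.
-- "At most n points on L" is expressed by bounding every set of (indices of)
-- arc points that all lie on L, since incidence need not be decidable.
record ProjectiveArc {p ℓ l i} (𝓘 : IncidenceStructure p ℓ l i) (k n : ℕ) : Set (p ⊔ ℓ ⊔ l ⊔ i) where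
  open IncidenceStructure 𝓘
  field
    points   : Vector Point k
    distinct : Injective _≡_ _≈ₚ_ points
    atMost   : ∀ (L : Line) (S : Subset k) → (∀ {j} → j ∈ S → points j I L) → ∣ S ∣ ≤ n

ℤ₂₅ : CommutativeRing 0ℓ 0ℓ
ℤ₂₅ = ℤ.+-*-commutativeRing /⟨ ℤ.+ 25 ⟩

𝔽₅ : CommutativeRing 0ℓ 0ℓ
𝔽₅ = ℤ.+-*-commutativeRing /⟨ ℤ.+ 5 ⟩

𝕊₅ : CommutativeRing 0ℓ 0ℓ
𝕊₅ = polynomialRing /⟨ X ⊛ X ⟩
  where open Polynomial 𝔽₅

{-# OPTIONS --safe #-}
module Submission where

open import Defs
open import Algebra.Bundles using (CommutativeRing)
open import Algebra.Definitions.RawMagma using (_,_)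
open import Data.Bool.Base using (Bool; true; false; T; not; _∧_; _∨_)
open import Data.Bool.ListAction using (all; any)
open import Data.Fin.Base using (Fin; zero; suc)
open import Data.Fin.Patterns using (0F; 1F; 2F)
open import Data.Fin.Subset using (Subset; inside; outside; _∈_; ∣_∣)
open import Data.Integer.Base using (ℤ; +_)
open import Data.List.Base using (List; []; _∷_; cartesianProduct; cartesianProductWith; concat; drop; filterᵇ; length; lookup; map; upTo; zipWith)
open import Data.List.Membership.Propositional using () renaming (_∈_ to _∈ₗ_)
open import Data.List.Membership.Propositional.Properties using (∈-upTo⁺; ∈-lookup)
open import Data.List.Relation.Unary.All.Properties using (all⁺)
open import Data.List.Relation.Unary.Any.Properties using (any⁻)
open import Data.Nat.Base using (ℕ; zero; suc; NonZero; _≤_; _<_; _≤ᵇ_; _≡ᵇ_; _%_; _/_; z≤n; s≤s) renaming (_+_ to _+ℕ_; _*_ to _*ℕ_)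
open import Data.Nat.DivMod using (m%n<n; m<n*o⇒m/o<n; m≡m%n+[m/n]*n; m*n%n≡0)
open import Data.Nat.Properties using (≤ᵇ⇒≤; ≤-trans; m≤n⇒m≤1+n; ≡ᵇ⇒≡; ≡⇒≡ᵇ)
open import Data.Product.Base using (_×_; _,_; ∃-syntax)
open import Data.Sum.Base as Sum using (_⊎_; inj₁; inj₂; [_,_]′)
open import Data.Vec.Base using ([]; _∷_; here; there)
open import Data.Vec.Functional using (Vector)
open import Function.Base using (_∘_)
open import Level using (Level; _⊔_)
open import Relation.Binary.PropositionalEquality.Core using (_≡_; refl; cong; cong₂; subst)
open import Relation.Nullary.Negation using (¬_; contradiction)
import Algebra.Properties.Group as GroupProperties
import Algebra.Solver.Ring.NaturalCoefficients.Default as SemiringSolver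
import Data.Integer.Base as ℤ
import Data.Integer.DivMod as ℤ
import Data.Integer.Properties as ℤ
import Data.Integer.Tactic.RingSolver as ℤ-Solver
import Data.List.Relation.Unary.All as All
import Data.List.Relation.Unary.Any as Any
import Data.Nat.Properties as ℕ
import Data.Nat.Tactic.RingSolver as ℕ-Solver
import Relation.Binary.PropositionalEquality.Core as ≡
import Relation.Binary.Reasoning.Setoid as ≈-Reasoning

-- Let π be 5 in ℤ₂₅ and X in 𝕊₅; points and lines that agree modulo π are
-- called neighbours.  A neighbour class of points is an affine plane of order
-- 5, and a line running through the class meets it in one of the 5 parallel
-- segments whose direction is the class of the line.  So if a class consists
-- of a parallel segments, it contributes a points to each line through it that
-- is not along the segments, and 0 or 5 points to each line that is.
--
-- All arcs are such unions of segments and avoid the class of u = (1 : 0 : 0).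
-- On some lines through u modulo π ("radial" ones) every segment points to u,
-- and the segments are chosen such that each line of PHG(2,R) over the radial
-- line contains at most 3 of them.  On the remaining lines through u the
-- segments of a class point along a line that misses u and that meets the
-- radial classes in few points.  For (355,15), say, four lines through u are
-- radial; three of these have 2 segments in each class, the fourth one has
-- 1, 1, 3, 3, 3.  The other two have 3 segments in each class, all pointing
-- to the first, respectively second, of the classes with a single segment.
-- A line missing u modulo π then has at most 3 + 3 + 2 + 2 + 2 + 3 or
-- 5 + 3 + 2 + 2 + 2 + 1 points, and a line over one of the last two has
-- 3 points in each of 5 classes.  None of this depends on which of the two
-- rings is used, and elements a₀ + a₁ π can be handled as pairs of naturals.
--
-- A free submodule of rank 2 lies in the orthogonal complement of the cross
-- product of its basis, which has a unit among its coordinates.  There are 775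
-- such normal vectors up to units, and the bound is checked for each of them.

-- Normal vectors of free submodules of rank 2

module Normals {c ℓ : Level} (R : CommutativeRing c ℓ) where
  open CommutativeRing R hiding (zero) renaming (refl to ≈-refl)
  open SemiringSolver commutativeSemiring using (solve; _:=_; _:+_; _:*_; con)
  open ≈-Reasoning setoid

  R³ = freeRightModule ring 3

  infix 8 _∙_
  _∙_ : Vector Carrier 3 → Vector Carrier 3 → Carrier
  u ∙ v = u 0F * v 0F + u 1F * v 1F + u 2F * v 2F

  ∙-congˡ : ∀ u {v w} → (∀ i → v i ≈ w i) → u ∙ v ≈ u ∙ w
  ∙-congˡ u v≈w = +-cong (+-cong (*-congˡ (v≈w 0F)) (*-congˡ (v≈w 1F))) (*-congˡ (v≈w 2F))

  ∙-congʳ : ∀ {u w} v → (∀ i → u i ≈ w i) → u ∙ v ≈ w ∙ v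
  ∙-congʳ v u≈w = +-cong (+-cong (*-congʳ (u≈w 0F)) (*-congʳ (u≈w 1F))) (*-congʳ (u≈w 2F))

  scale-∙ : ∀ u v r → (λ i → u i * r) ∙ v ≈ r * u ∙ v
  scale-∙ u v r = solve 7 (λ a b c x y z r →
    a :* r :* x :+ b :* r :* y :+ c :* r :* z := r :* (a :* x :+ b :* y :+ c :* z))
    ≈-refl (u 0F) (u 1F) (u 2F) (v 0F) (v 1F) (v 2F) r

  -- Differences are written a + -1# * b: with -1# replaced by an indeterminate,
  -- the identities below hold in every commutative semiring.
  -1# : Carrier
  -1# = - 1#

  [1-1]*x≈0 : ∀ x → (1# + -1#) * x ≈ 0#
  [1-1]*x≈0 x = trans (*-congʳ (-‿inverseʳ 1#)) (zeroˡ x)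

  minor : (u v : Vector Carrier 3) (i k : Fin 3) → Carrier
  minor u v i k = u i * v k + -1# * (v i * u k)

  cross : Vector Carrier 3 → Vector Carrier 3 → Vector Carrier 3
  cross u v 0F = minor u v 1F 2F
  cross u v 1F = minor u v 2F 0F
  cross u v 2F = minor u v 0F 1F

  -- This is the determinant with rows u, v and u s + v t: its positive and negative halves agree
  -- once the third row is expanded. The trailing `0#` is how `linearCombination` unfolds.
  cross-∙ : ∀ u v s t → cross u v ∙ (λ i → u i * s + (v i * t + 0#)) ≈ 0#
  cross-∙ u v s t = trans
    (solve 9 (λ n a b c x y z s t →
      let p = a :* s :+ (x :* t :+ con 0)
          q = b :* s :+ (y :* t :+ con 0)
          r = c :* s :+ (z :* t :+ con 0)
      in  (b :* z :+ n :* (y :* c)) :* p :+ (c :* x :+ n :* (z :* a)) :* q :+ (a :* y :+ n :* (x :* b)) :* r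
          := (con 1 :+ n) :* (b :* z :* p :+ c :* x :* q :+ a :* y :* r))
      ≈-refl -1# (u 0F) (u 1F) (u 2F) (v 0F) (v 1F) (v 2F) s t)
    ([1-1]*x≈0 _)

  module _ (π : Carrier) where

    minor-diagonal : ∀ u v i → π * minor u v i i ≈ 0#
    minor-diagonal u v i = trans
      (solve 4 (λ π n a b → π :* (a :* b :+ n :* (b :* a)) := (con 1 :+ n) :* (π :* (a :* b)))
        ≈-refl π -1# (u i) (v i))
      ([1-1]*x≈0 _)

    minor-swap : ∀ u v i k → π * minor u v i k ≈ 0# → π * minor u v k i ≈ 0#
    minor-swap u v i k e = begin
      π * minor u v k i                         ≈⟨ +-identityʳ _ ⟨
      π * minor u v k i + 0#                    ≈⟨ +-congˡ e ⟨
      π * minor u v k i + π * minor u v i k     ≈⟨ solve 6 (λ π n a b c d →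
        π :* (a :* b :+ n :* (c :* d)) :+ π :* (d :* c :+ n :* (b :* a))
          := (con 1 :+ n) :* (π :* (a :* b :+ c :* d))) ≈-refl π -1# (u k) (v i) (v k) (u i) ⟩
      (1# + -1#) * _                            ≈⟨ [1-1]*x≈0 _ ⟩
      0#                                        ∎

    -- Up to sign every minor is a coordinate of the cross product or a diagonal one, which
    -- vanishes. Independence is applied to whole vectors, hence to all nine index pairs.
    all-minors : ∀ u v → (∀ i → π * cross u v i ≈ 0#) → ∀ i k → π * minor u v i k ≈ 0#
    all-minors u v e 0F 0F = minor-diagonal u v 0F
    all-minors u v e 0F 1F = e 2F
    all-minors u v e 0F 2F = minor-swap u v 2F 0F (e 1F)
    all-minors u v e 1F 0F = minor-swap u v 0F 1F (e 2F)
    all-minors u v e 1F 1F = minor-diagonal u v 1F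
    all-minors u v e 1F 2F = e 0F
    all-minors u v e 2F 0F = e 1F
    all-minors u v e 2F 1F = minor-swap u v 1F 2F (e 0F)
    all-minors u v e 2F 2F = minor-diagonal u v 2F

    module _ {p} (L : FreeSubmodule R³ p 2) where
      open FreeSubmodule L
      open IsBasis isBasis

      u v : Vector Carrier 3
      u = basis 0F
      v = basis 1F

      normal : Vector Carrier 3
      normal = cross u v

      normal-⊥ : ∀ {x} → member x → normal ∙ x ≈ 0#
      normal-⊥ {x} x∈L with s , x≈ ← spanning x∈L =
        trans (∙-congˡ normal x≈) (cross-∙ u v (s 0F) (s 1F))

      pair : Carrier → Carrier → Vector Carrier 2
      pair s t 0F = s
      pair s t 1F = t

      -- The relation π (uᵢ v - vᵢ u) ≈ 0 forces π uᵢ ≈ 0 for every i, and then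
      -- π u ≈ 0 contradicts independence once more.
      normal≉0 : ¬ π ≈ 0# → ¬ (∀ i → π * normal i ≈ 0#)
      normal≉0 π≉0 e = π≉0 (independent (pair π 0#) πu≈0 0F)
        where
        relation : ∀ i k → u k * (-1# * (π * v i)) + (v k * (π * u i) + 0#) ≈ 0#
        relation i k = trans
          (solve 6 (λ π n a b c d →
            a :* (n :* (π :* b)) :+ (c :* (π :* d) :+ con 0) := π :* (d :* c :+ n :* (b :* a)))
            ≈-refl π -1# (u k) (v i) (v k) (u i))
          (all-minors u v e i k)
        πu : ∀ i → π * u i ≈ 0#
        πu i = independent (pair (-1# * (π * v i)) (π * u i)) (relation i) 1F
        πu≈0 : ∀ k → u k * π + (v k * 0# + 0#) ≈ 0#
        πu≈0 k = begin
          u k * π + (v k * 0# + 0#)   ≈⟨ solve 3 (λ π a b → a :* π :+ (b :* con 0 :+ con 0) := π :* a) ≈-refl π (u k) (v k) ⟩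
          π * u k                     ≈⟨ πu k ⟩
          0#                          ∎

-- Boolean tests and counting by filters

all-lookup : ∀ {a} {A : Set a} (p : A → Bool) xs {x} → T (all p xs) → x ∈ₗ xs → T (p x)
all-lookup p xs h x∈xs = All.lookup (all⁺ p xs h) x∈xs

∧-proj₁ : ∀ a b → T (a ∧ b) → T a
∧-proj₁ true _ _ = _

∧-proj₂ : ∀ a b → T (a ∧ b) → T b
∧-proj₂ true _ h = h

∧-intro : ∀ a b → T a → T b → T (a ∧ b)
∧-intro true _ _ h = h

∨-elim : ∀ a b → T (a ∨ b) → T a ⊎ T b
∨-elim true  _ _ = inj₁ _
∨-elim false _ h = inj₂ h

T-not⁻ : ∀ b → T (not b) → ¬ T b
T-not⁻ false _ ()

-- Turns the bound on index sets in `ProjectiveArc` into the length of a computed list.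
∣S∣≤∣filter∣ : ∀ {a} {A : Set a} (p : A → Bool) xs (S : Subset (length xs)) →
              (∀ {j} → j ∈ S → T (p (lookup xs j))) → ∣ S ∣ ≤ length (filterᵇ p xs)
∣S∣≤∣filter∣ p []       []            h = z≤n
∣S∣≤∣filter∣ p (x ∷ xs) (outside ∷ S) h with p x
... | true  = m≤n⇒m≤1+n (∣S∣≤∣filter∣ p xs S (h ∘ there))
... | false = ∣S∣≤∣filter∣ p xs S (h ∘ there)
∣S∣≤∣filter∣ p (x ∷ xs) (inside ∷ S) h with p x | h here
... | true | _ = s≤s (∣S∣≤∣filter∣ p xs S (h ∘ there))

-- Prefiltering by a weaker test loses nothing, so points far from a line can be discarded once for
-- its whole neighbour class.
filter-filter : ∀ {a} {A : Set a} (p q : A → Bool) (xs : List A) → (∀ x → T (p x) → T (q x)) →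
                length (filterᵇ p xs) ≤ length (filterᵇ p (filterᵇ q xs))
filter-filter p q []       h = z≤n
filter-filter p q (x ∷ xs) h with q x | h x
filter-filter p q (x ∷ xs) h | true | _ with p x
... | true  = s≤s (filter-filter p q xs h)
... | false = filter-filter p q xs h
filter-filter p q (x ∷ xs) h | false | hx with p x
... | true  = contradiction (hx _) λ ()
... | false = filter-filter p q xs h

-- Codes of ring elements and finite checks on lists of points

-- (a₀ , a₁) stands for a₀ + a₁ π, where π² = 0.
Code : Set
Code = ℕ × ℕ

Triple : Set
Triple = Code × Code × Code

infixl 8 _⊞_
infixl 9 _⊠_ _⊙_

-- Components are never reduced modulo 5: one formula then serves both rings, and the carry of ℤ₂₅
-- is left to `zeroᵇ`.
_⊞_ _⊠_ : Code → Code → Code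
(a₀ , a₁) ⊞ (b₀ , b₁) = a₀ +ℕ b₀ , a₁ +ℕ b₁
(a₀ , a₁) ⊠ (b₀ , b₁) = a₀ *ℕ b₀ , a₀ *ℕ b₁ +ℕ a₁ *ℕ b₀

_⊙_ : Triple → Triple → Code
(a , b , c) ⊙ (x , y , z) = a ⊠ x ⊞ b ⊠ y ⊞ c ⊠ z

1ᶜ πᶜ : Code
1ᶜ = 1 , 0
πᶜ = 0 , 1

digits : List ℕ
digits = upTo 5

module Check (zeroᵇ : Code → Bool) where

  -- 24 represents -1 in both rings.
  infix 7 _≐ᵇ_
  _≐ᵇ_ : Code → Code → Bool
  a ≐ᵇ b = zeroᵇ (a ⊞ (24 , 0) ⊠ b)

  everyᵇ someᵇ : (ℕ → ℕ → Bool) → Bool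
  everyᵇ f = all (λ s → all (f s) digits) digits
  someᵇ f = any (λ s → any (f s) digits) digits

  unitᵇ : Code → Bool
  unitᵇ a = someᵇ λ b₀ b₁ → a ⊠ (b₀ , b₁) ≐ᵇ 1ᶜ

  nonunitOrUnitᵇ : ℕ → ℕ → Bool
  nonunitOrUnitᵇ a₀ a₁ = zeroᵇ (πᶜ ⊠ (a₀ , a₁)) ∨ unitᵇ (a₀ , a₁)

  incidentᵇ : Triple → Triple → Bool
  incidentᵇ l p = zeroᵇ (l ⊙ p)

  -- Multiplication by π keeps only the residue, so this is incidence modulo π.
  nearᵇ : Triple → Triple → Bool
  nearᵇ l p = zeroᵇ (πᶜ ⊠ (l ⊙ p))

  atMostᵇ : ℕ → List Triple → Triple → Bool
  atMostᵇ n ps l = length (filterᵇ (incidentᵇ l) ps) ≤ᵇ n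

  atMostOnEachᵇ : ℕ → (ℕ → ℕ → Triple) → List Triple → Bool
  atMostOnEachᵇ n l ps = everyᵇ λ s t → atMostᵇ n ps (l s t)

  -- The lines l s t form a neighbour class; incidence modulo π depends on the
  -- class only, which leaves few points to be tested against each line.
  atMostInClassᵇ : ℕ → List Triple → (ℕ → ℕ → Triple) → Bool
  atMostInClassᵇ n ps l = atMostOnEachᵇ n l (filterᵇ (nearᵇ (l 0 0)) ps)

  -- Normal vectors up to units are sorted by their first unit coordinate, which is scaled to 1; the
  -- coordinates before it are multiples of π.
  lines₀ : ℕ → ℕ → ℕ → ℕ → Triple
  lines₀ b₀ c₀ s t = 1ᶜ , (b₀ , s) , (c₀ , t)

  lines₁ : ℕ → ℕ → ℕ → Triple
  lines₁ c₀ s t = (0 , s) , 1ᶜ , (c₀ , t)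

  lines₂ : ℕ → ℕ → Triple
  lines₂ s t = (0 , s) , (0 , t) , 1ᶜ

  atMostOnLinesᵇ : ℕ → List Triple → Bool
  atMostOnLinesᵇ n ps =
      everyᵇ (λ b₀ c₀ → atMostInClassᵇ n ps (lines₀ b₀ c₀))
    ∧ all (λ c₀ → atMostInClassᵇ n ps (lines₁ c₀)) digits
    ∧ atMostInClassᵇ n ps lines₂

  normalisedᵇ : Triple → Bool
  normalisedᵇ (a , b , c) = a ≐ᵇ 1ᶜ ∨ b ≐ᵇ 1ᶜ ∨ c ≐ᵇ 1ᶜ

  proportionalᵇ : Triple → Triple → Bool
  proportionalᵇ (a , b , c) (x , y , z) = (a ⊠ y ≐ᵇ b ⊠ x) ∧ (a ⊠ z ≐ᵇ c ⊠ x) ∧ (b ⊠ z ≐ᵇ c ⊠ y)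

  distinctᵇ : List Triple → Bool
  distinctᵇ []       = true
  distinctᵇ (p ∷ ps) = all (not ∘ proportionalᵇ p) ps ∧ distinctᵇ ps

  every-lookup : ∀ f {s t} → T (everyᵇ f) → s < 5 → t < 5 → T (f s t)
  every-lookup f {s} h s<5 t<5 =
    all-lookup (f s) digits (all-lookup (λ s → all (f s) digits) digits h (∈-upTo⁺ s<5)) (∈-upTo⁺ t<5)

  some-satisfied : ∀ f → T (someᵇ f) → ∃[ s ] ∃[ t ] T (f s t)
  some-satisfied f h with s , hₛ ← Any.satisfied (any⁻ (λ s → any (f s) digits) digits h) =
    s , Any.satisfied (any⁻ (f s) digits hₛ)

-- Interface between codes and a ring

record Coding {c ℓ : Level} (R : CommutativeRing c ℓ) : Set (c ⊔ ℓ) where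
  open CommutativeRing R using (Carrier; _≈_; _+_; _*_; 0#; 1#)
  field
    ⟦_⟧            : Code → Carrier
    ⟦⟧-+           : ∀ a b → ⟦ a ⊞ b ⟧ ≈ ⟦ a ⟧ + ⟦ b ⟧
    ⟦⟧-*           : ∀ a b → ⟦ a ⊠ b ⟧ ≈ ⟦ a ⟧ * ⟦ b ⟧
    ⟦1⟧            : ⟦ 1ᶜ ⟧ ≈ 1#
    expand         : ∀ x → ∃[ a₀ ] ∃[ a₁ ] (a₀ < 5 × a₁ < 5 × x ≈ ⟦ a₀ , a₁ ⟧)
    zeroᵇ          : Code → Bool
    zeroᵇ-sound    : ∀ a → T (zeroᵇ a) → ⟦ a ⟧ ≈ 0#
    zeroᵇ-complete : ∀ a → ⟦ a ⟧ ≈ 0# → T (zeroᵇ a)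
    25≈0           : T (zeroᵇ (25 , 0))
    π*digit≉0      : ∀ {d} → suc d < 5 → ¬ T (zeroᵇ (0 , suc d))
    local          : T (Check.everyᵇ zeroᵇ (Check.nonunitOrUnitᵇ zeroᵇ))

-- From the finite checks to projective arcs

module Arcs {c ℓ : Level} (R : CommutativeRing c ℓ) (coding : Coding R) where
  open CommutativeRing R hiding (zero) renaming (refl to ≈-refl)
  open Coding coding
  open Check zeroᵇ
  open Normals R
  open ≈-Reasoning setoid
  open SemiringSolver commutativeSemiring using (solve; _:=_; _:*_)

  π : Carrier
  π = ⟦ πᶜ ⟧

  25*x≈0 : ∀ a → ⟦ a ⟧ + ⟦ (24 , 0) ⊠ a ⟧ ≈ 0#
  25*x≈0 a = begin
    ⟦ a ⟧ + ⟦ (24 , 0) ⊠ a ⟧              ≈⟨ +-cong (trans (*-congʳ ⟦1⟧) (*-identityˡ _)) (sym (⟦⟧-* _ a)) ⟨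
    ⟦ 1ᶜ ⟧ * ⟦ a ⟧ + ⟦ 24 , 0 ⟧ * ⟦ a ⟧   ≈⟨ distribʳ ⟦ a ⟧ _ _ ⟨
    (⟦ 1ᶜ ⟧ + ⟦ 24 , 0 ⟧) * ⟦ a ⟧         ≈⟨ *-congʳ (⟦⟧-+ 1ᶜ (24 , 0)) ⟨
    ⟦ 25 , 0 ⟧ * ⟦ a ⟧                    ≈⟨ *-congʳ (zeroᵇ-sound (25 , 0) 25≈0) ⟩
    0# * ⟦ a ⟧                            ≈⟨ zeroˡ _ ⟩
    0#                                    ∎

  ≐ᵇ-sound : ∀ a b → T (a ≐ᵇ b) → ⟦ a ⟧ ≈ ⟦ b ⟧
  ≐ᵇ-sound a b h = begin
    ⟦ a ⟧                                   ≈⟨ +-identityʳ _ ⟨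
    ⟦ a ⟧ + 0#                              ≈⟨ +-congˡ (trans (+-comm _ _) (25*x≈0 b)) ⟨
    ⟦ a ⟧ + (⟦ (24 , 0) ⊠ b ⟧ + ⟦ b ⟧)      ≈⟨ +-assoc _ _ _ ⟨
    ⟦ a ⟧ + ⟦ (24 , 0) ⊠ b ⟧ + ⟦ b ⟧        ≈⟨ +-congʳ (⟦⟧-+ a _) ⟨
    ⟦ a ⊞ (24 , 0) ⊠ b ⟧ + ⟦ b ⟧            ≈⟨ +-congʳ (zeroᵇ-sound _ h) ⟩
    0# + ⟦ b ⟧                              ≈⟨ +-identityˡ _ ⟩
    ⟦ b ⟧                                   ∎

  ≐ᵇ-complete : ∀ a b → ⟦ a ⟧ ≈ ⟦ b ⟧ → T (a ≐ᵇ b)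
  ≐ᵇ-complete a b e = zeroᵇ-complete _ (trans (⟦⟧-+ a _) (trans (+-congʳ e) (25*x≈0 b)))

  Unit : Carrier → Set (c ⊔ ℓ)
  Unit x = ∃[ y ] (x * y ≈ 1#)

  π*-absorb : ∀ {x r} → π * x ≈ 0# → π * (x * r) ≈ 0#
  π*-absorb e = trans (sym (*-assoc _ _ _)) (trans (*-congʳ e) (zeroˡ _))

  unitᵇ-sound : ∀ a → T (unitᵇ a) → Unit ⟦ a ⟧
  unitᵇ-sound a h with b₀ , b₁ , e ← some-satisfied (λ b₀ b₁ → a ⊠ (b₀ , b₁) ≐ᵇ 1ᶜ) h =
    ⟦ b₀ , b₁ ⟧ , trans (sym (⟦⟧-* a _)) (trans (≐ᵇ-sound (a ⊠ (b₀ , b₁)) 1ᶜ e) ⟦1⟧)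

  nonunit-or-unit : ∀ x → π * x ≈ 0# ⊎ Unit x
  nonunit-or-unit x =
    let a₀ , a₁ , a₀<5 , a₁<5 , x≈a = expand x
    in  Sum.map (λ h → trans (*-congˡ x≈a) (trans (sym (⟦⟧-* πᶜ _)) (zeroᵇ-sound _ h)))
                (λ h → let y , e = unitᵇ-sound (a₀ , a₁) h in y , trans (*-congʳ x≈a) e)
                (∨-elim (zeroᵇ (πᶜ ⊠ (a₀ , a₁))) (unitᵇ (a₀ , a₁)) (every-lookup nonunitOrUnitᵇ local a₀<5 a₁<5))

  -- As π (a₀ + a₁ π) = a₀ π, a nonzero digit a₀ would contradict `π*digit≉0`.
  expand-nonunit : ∀ x → π * x ≈ 0# → ∃[ s ] (s < 5 × x ≈ ⟦ 0 , s ⟧)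
  expand-nonunit x e with expand x
  ... | zero   , s , _    , s<5 , x≈s = s , s<5 , x≈s
  ... | suc a₀ , s , a₀<5 , _   , x≈s = contradiction
    (subst (λ k → T (zeroᵇ (0 , k))) (ℕ.+-identityʳ _)
      (zeroᵇ-complete _ (trans (⟦⟧-* πᶜ _) (trans (*-congˡ (sym x≈s)) e))))
    (π*digit≉0 a₀<5)

  π≉0 : ¬ π ≈ 0#
  π≉0 e = π*digit≉0 (s≤s (s≤s z≤n)) (zeroᵇ-complete πᶜ e)

  vector : Triple → Vector Carrier 3
  vector (a , b , c) 0F = ⟦ a ⟧
  vector (a , b , c) 1F = ⟦ b ⟧
  vector (a , b , c) 2F = ⟦ c ⟧

  vector-∙ : ∀ p q → vector p ∙ vector q ≈ ⟦ p ⊙ q ⟧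
  vector-∙ (a , b , c) (x , y , z) = sym (begin
    ⟦ a ⊠ x ⊞ b ⊠ y ⊞ c ⊠ z ⟧                          ≈⟨ ⟦⟧-+ _ _ ⟩
    ⟦ a ⊠ x ⊞ b ⊠ y ⟧ + ⟦ c ⊠ z ⟧                      ≈⟨ +-congʳ (⟦⟧-+ _ _) ⟩
    ⟦ a ⊠ x ⟧ + ⟦ b ⊠ y ⟧ + ⟦ c ⊠ z ⟧                  ≈⟨ +-cong (+-cong (⟦⟧-* a x) (⟦⟧-* b y)) (⟦⟧-* c z) ⟩
    ⟦ a ⟧ * ⟦ x ⟧ + ⟦ b ⟧ * ⟦ y ⟧ + ⟦ c ⟧ * ⟦ z ⟧      ∎)

  normalised : ∀ p → T (normalisedᵇ p) → ∃[ i ] (vector p i ≈ 1#)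
  normalised (a , b , c) h with ∨-elim (a ≐ᵇ 1ᶜ) _ h
  ... | inj₁ h = 0F , trans (≐ᵇ-sound a 1ᶜ h) ⟦1⟧
  ... | inj₂ h with ∨-elim (b ≐ᵇ 1ᶜ) _ h
  ...   | inj₁ h = 1F , trans (≐ᵇ-sound b 1ᶜ h) ⟦1⟧
  ...   | inj₂ h = 2F , trans (≐ᵇ-sound c 1ᶜ h) ⟦1⟧

  point : (v : Vector Carrier 3) → ∃[ i ] (v i ≈ 1#) → FreeSubmodule R³ (c ⊔ ℓ) 1
  point v (i , vᵢ≈1) = record
    { submodule = record
      { member   = λ x → ∃[ s ] (∀ k → x k ≈ v k * s)
      ; resp     = λ x≈y (s , e) → s , λ k → trans (sym (x≈y k)) (e k)
      ; 0-closed = 0# , λ k → sym (zeroʳ (v k))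
      ; +-closed = λ (s , e) (t , f) → s + t , λ k → trans (+-cong (e k) (f k)) (sym (distribˡ (v k) s t))
      ; *-closed = λ (s , e) t → s * t , λ k → trans (*-congʳ (e k)) (*-assoc (v k) s t)
      }
    ; basis   = λ _ → v
    ; isBasis = record
      { ∈-member    = λ _ → v∈
      ; spanning    = λ (s , e) → (λ _ → s) , λ k → trans (e k) (sym (+-identityʳ _))
      -- The coordinate of v that equals 1 reads off the coefficient.
      ; independent = λ { s e 0F → begin
          s 0F              ≈⟨ *-identityˡ _ ⟨
          1# * s 0F         ≈⟨ *-congʳ vᵢ≈1 ⟨
          v i * s 0F        ≈⟨ +-identityʳ _ ⟨
          v i * s 0F + 0#   ≈⟨ e i ⟩
          0#                ∎ }
      }
    }
    where
    v∈ : ∃[ s ] (∀ k → v k ≈ v k * s)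
    v∈ = 1# , λ k → sym (*-identityʳ (v k))

  -- Multiples have vanishing minors, so vectors that fail `proportionalᵇ` span different points.
  proportional : ∀ p q s → (∀ k → vector p k ≈ vector q k * s) → T (proportionalᵇ p q)
  proportional (a , b , c) (x , y , z) s e =
    ∧-intro (a ⊠ y ≐ᵇ b ⊠ x) _ (minor≈0 a b x y (e 0F) (e 1F))
      (∧-intro (a ⊠ z ≐ᵇ c ⊠ x) _ (minor≈0 a c x z (e 0F) (e 2F)) (minor≈0 b c y z (e 1F) (e 2F)))
    where
    minor≈0 : ∀ a b x y → ⟦ a ⟧ ≈ ⟦ x ⟧ * s → ⟦ b ⟧ ≈ ⟦ y ⟧ * s → T (a ⊠ y ≐ᵇ b ⊠ x)
    minor≈0 a b x y e f = ≐ᵇ-complete (a ⊠ y) (b ⊠ x) (begin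
      ⟦ a ⊠ y ⟧               ≈⟨ ⟦⟧-* a y ⟩
      ⟦ a ⟧ * ⟦ y ⟧           ≈⟨ *-congʳ e ⟩
      ⟦ x ⟧ * s * ⟦ y ⟧       ≈⟨ solve 3 (λ x s y → x :* s :* y := y :* s :* x) ≈-refl ⟦ x ⟧ s ⟦ y ⟧ ⟩
      ⟦ y ⟧ * s * ⟦ x ⟧       ≈⟨ *-congʳ f ⟨
      ⟦ b ⟧ * ⟦ x ⟧           ≈⟨ ⟦⟧-* b x ⟨
      ⟦ b ⊠ x ⟧               ∎)

  head-distinct : ∀ p ps → T (distinctᵇ (p ∷ ps)) → ∀ j → ¬ T (proportionalᵇ p (lookup ps j))
  head-distinct p ps d j = T-not⁻ (proportionalᵇ p (lookup ps j))
    (all-lookup (not ∘ proportionalᵇ p) ps (∧-proj₁ (all (not ∘ proportionalᵇ p) ps) _ d) (∈-lookup j))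

  -- `distinctᵇ` compares an entry with later ones only; proportionality in both orders covers i < j
  -- and j < i.
  distinct⇒injective : ∀ ps → T (distinctᵇ ps) → ∀ i j →
    T (proportionalᵇ (lookup ps i) (lookup ps j)) → T (proportionalᵇ (lookup ps j) (lookup ps i)) → i ≡ j
  distinct⇒injective (p ∷ ps) d zero    zero    _  _  = refl
  distinct⇒injective (p ∷ ps) d zero    (suc j) pq _  = contradiction pq (head-distinct p ps d j)
  distinct⇒injective (p ∷ ps) d (suc i) zero    _  qp = contradiction qp (head-distinct p ps d i)
  distinct⇒injective (p ∷ ps) d (suc i) (suc j) pq qp =
    cong suc (distinct⇒injective ps (∧-proj₂ (all (not ∘ proportionalᵇ p) ps) _ d) i j pq qp)

  -- The normal vector annihilates L, and so does every multiple of it.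
  on-line : ∀ {p} (L : FreeSubmodule R³ p 2) l r → (∀ i → normal π L i * r ≈ vector l i) →
            ∀ q → FreeSubmodule.member L (vector q) → T (incidentᵇ l q)
  on-line L l r e q q∈L = zeroᵇ-complete (l ⊙ q) (begin
    ⟦ l ⊙ q ⟧                                 ≈⟨ vector-∙ l q ⟨
    vector l ∙ vector q                       ≈⟨ ∙-congʳ (vector q) e ⟨
    (λ i → normal π L i * r) ∙ vector q       ≈⟨ scale-∙ (normal π L) (vector q) r ⟩
    r * normal π L ∙ vector q                 ≈⟨ *-congˡ (normal-⊥ π L q∈L) ⟩
    r * 0#                                    ≈⟨ zeroʳ r ⟩
    0#                                        ∎)

  module _ (n : ℕ) (ps : List Triple) where

    -- A line is encoded by its normal vector.
    Bounded : Triple → Set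
    Bounded l = length (filterᵇ (incidentᵇ l) ps) ≤ n

    -- A point on `l s t` lies on `l 0 0` modulo π, so the prefiltered list still contains every
    -- point of the line.
    class-bounded : ∀ (l : ℕ → ℕ → Triple) →
      (∀ s t p → πᶜ ⊠ (l s t ⊙ p) ≡ πᶜ ⊠ (l 0 0 ⊙ p)) →
      T (atMostInClassᵇ n ps l) → ∀ {s t} → s < 5 → t < 5 → Bounded (l s t)
    class-bounded l same h {s} {t} s<5 t<5 =
      ≤-trans (filter-filter (incidentᵇ (l s t)) (nearᵇ (l 0 0)) ps residue)
        (≤ᵇ⇒≤ _ n (every-lookup (λ s t → atMostᵇ n (filterᵇ (nearᵇ (l 0 0)) ps) (l s t)) h s<5 t<5))
      where
      residue : ∀ p → T (incidentᵇ (l s t) p) → T (nearᵇ (l 0 0) p)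
      residue p h = subst (T ∘ zeroᵇ) (same s t p) (zeroᵇ-complete _
        (trans (⟦⟧-* πᶜ _) (trans (*-congˡ (zeroᵇ-sound _ h)) (zeroʳ _))))

    module _ (h : T (atMostOnLinesᵇ n ps)) where
      private
        all₀ all₁ all₂ : Bool
        all₀ = everyᵇ (λ b₀ c₀ → atMostInClassᵇ n ps (lines₀ b₀ c₀))
        all₁ = all (λ c₀ → atMostInClassᵇ n ps (lines₁ c₀)) digits
        all₂ = atMostInClassᵇ n ps lines₂
        h₀ : T all₀
        h₀ = ∧-proj₁ all₀ (all₁ ∧ all₂) h
        h₁ : T all₁
        h₁ = ∧-proj₁ all₁ all₂ (∧-proj₂ all₀ (all₁ ∧ all₂) h)
        h₂ : T all₂
        h₂ = ∧-proj₂ all₁ all₂ (∧-proj₂ all₀ (all₁ ∧ all₂) h)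

      Normalised : Vector Carrier 3 → Set (c ⊔ ℓ)
      Normalised w = ∃[ l ] (Bounded l × ∃[ r ] (∀ i → w i * r ≈ vector l i))

      normalise₀ : ∀ w → Unit (w 0F) → Normalised w
      normalise₀ w (r , e) =
        let b₀ , s , b₀<5 , s<5 , b = expand (w 1F * r)
            c₀ , t , c₀<5 , t<5 , c = expand (w 2F * r)
        in  lines₀ b₀ c₀ s t ,
            -- After multiplication by `πᶜ` only residues remain, in which s and t do not occur, so
            -- both sides compute to the same term.
            class-bounded (lines₀ b₀ c₀) (λ _ _ _ → refl)
              (every-lookup (λ b₀ c₀ → atMostInClassᵇ n ps (lines₀ b₀ c₀)) h₀ b₀<5 c₀<5) s<5 t<5 ,
            r , λ { 0F → trans e (sym ⟦1⟧) ; 1F → b ; 2F → c }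

      normalise₁ : ∀ w → π * w 0F ≈ 0# → Unit (w 1F) → Normalised w
      normalise₁ w d (r , e) =
        let s , s<5 , a = expand-nonunit (w 0F * r) (π*-absorb d)
            c₀ , t , c₀<5 , t<5 , c = expand (w 2F * r)
        in  lines₁ c₀ s t ,
            class-bounded (lines₁ c₀) (λ _ _ _ → refl)
              (all-lookup (λ c₀ → atMostInClassᵇ n ps (lines₁ c₀)) digits h₁ (∈-upTo⁺ c₀<5)) s<5 t<5 ,
            r , λ { 0F → a ; 1F → trans e (sym ⟦1⟧) ; 2F → c }

      normalise₂ : ∀ w → π * w 0F ≈ 0# → π * w 1F ≈ 0# → Unit (w 2F) → Normalised w
      normalise₂ w d d′ (r , e) =
        let s , s<5 , a = expand-nonunit (w 0F * r) (π*-absorb d)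
            t , t<5 , b = expand-nonunit (w 1F * r) (π*-absorb d′)
        in  lines₂ s t , class-bounded lines₂ (λ _ _ _ → refl) h₂ s<5 t<5 ,
            r , λ { 0F → a ; 1F → b ; 2F → trans e (sym ⟦1⟧) }

      -- By locality a vector not killed by π has a unit coordinate; the first one is scaled to 1.
      normalise : ∀ w → ¬ (∀ i → π * w i ≈ 0#) → Normalised w
      normalise w w≉0 =
        [ (λ d → [ (λ d′ → [ (λ d″ → contradiction (λ { 0F → d ; 1F → d′ ; 2F → d″ }) w≉0)
                           , normalise₂ w d d′ ]′ (nonunit-or-unit (w 2F)))
                 , normalise₁ w d ]′ (nonunit-or-unit (w 1F)))
        , normalise₀ w ]′ (nonunit-or-unit (w 0F))

    projectiveArc : T (all normalisedᵇ ps) → T (distinctᵇ ps) → T (atMostOnLinesᵇ n ps) →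
      ProjectiveArc (PHG₂ ring) (length ps) n
    projectiveArc norm dist bound = record
      { points   = points
      ; distinct = λ {i} {j} (i⊆j , j⊆i) → distinct⇒injective ps dist i j (prop i j i⊆j) (prop j i j⊆i)
      ; atMost   = atMost
      }
      where
      points : Vector (FreeSubmodule R³ (c ⊔ ℓ) 1) (length ps)
      points j = point (vector (lookup ps j)) (normalised (lookup ps j) (all-lookup normalisedᵇ ps norm (∈-lookup j)))

      open FreeSubmodule

      prop : ∀ i j → (∀ {x} → member (points i) x → member (points j) x) →
             T (proportionalᵇ (lookup ps i) (lookup ps j))
      prop i j i⊆j = let s , e = i⊆j (IsBasis.∈-member (isBasis (points i)) 0F) in
        proportional (lookup ps i) (lookup ps j) s e

      atMost : ∀ (L : FreeSubmodule R³ (c ⊔ ℓ) 2) (S : Subset (length ps)) →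
               (∀ {j} → j ∈ S → ∀ {x} → member (points j) x → member L x) → ∣ S ∣ ≤ n
      atMost L S S⊆L = bounded (normalise bound (normal π L) (normal≉0 π L π≉0))
        where
        bounded : Normalised bound (normal π L) → ∣ S ∣ ≤ n
        bounded (l , l≤n , r , e) = ≤-trans
          (∣S∣≤∣filter∣ (incidentᵇ l) ps S λ {j} j∈S → on-line L l r e (lookup ps j)
            (S⊆L j∈S (IsBasis.∈-member (isBasis (points j)) 0F))) l≤n

-- Integers modulo m and the coding of ℤ₂₅

module Residues (m : ℕ) .{{_ : NonZero m}} where
  open CommutativeRing (ℤ.+-*-commutativeRing /⟨ + m ⟩) using (_≈_)

  shift : ∀ {x y} q → x ≡ y ℤ.+ q ℤ.* + m → x ≈ y
  shift {y = y} q refl = congruent (q , cancel q y (+ m))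
    where
    cancel : ∀ q y a → q ℤ.* a ≡ y ℤ.+ q ℤ.* a ℤ.- y
    cancel = ℤ-Solver.solve-∀

  shiftℕ : ∀ k q → + (k +ℕ q *ℕ m) ≈ + k
  shiftℕ k q = shift (+ q) (cong (ℤ._+_ (+ k)) (ℤ.pos-* q m))

  ≈-%ℕ : ∀ x → x ≈ + (x ℤ.%ℕ m)
  ≈-%ℕ x = shift (x ℤ./ℕ m) (ℤ.a≡a%ℕn+[a/ℕn]*n x m)

  %≡0⇒≈0 : ∀ k → T (k % m ≡ᵇ 0) → + k ≈ + 0
  %≡0⇒≈0 k h = shift (+ (k / m)) (≡.trans (cong +_ k≡) (≡.trans (ℤ.pos-* (k / m) m) (≡.sym (ℤ.+-identityˡ _))))
    where
    k≡ : k ≡ (k / m) *ℕ m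
    k≡ = ≡.trans (m≡m%n+[m/n]*n k m) (cong (_+ℕ (k / m) *ℕ m) (≡ᵇ⇒≡ _ 0 h))

  ≈0⇒%≡0 : ∀ k → + k ≈ + 0 → T (k % m ≡ᵇ 0)
  ≈0⇒%≡0 k (congruent (q , e)) = ≡⇒≡ᵇ _ 0 (≡.trans (cong (_% m) k≡) (m*n%n≡0 ℤ.∣ q ∣ m))
    where
    k≡ : k ≡ ℤ.∣ q ∣ *ℕ m
    -- Absolute values turn the integer multiplier into a natural one.
    k≡ = ≡.sym (≡.trans (≡.sym (ℤ.abs-* q (+ m))) (cong ℤ.∣_∣ (≡.trans e (ℤ.+-identityʳ (+ k)))))

ℤ₂₅-coding : Coding ℤ₂₅
ℤ₂₅-coding = record
  { ⟦_⟧            = ⟦_⟧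
  ; ⟦⟧-+           = λ (a₀ , a₁) (b₀ , b₁) → reflexive (cong +_ (sum a₀ a₁ b₀ b₁))
  ; ⟦⟧-*           = λ (a₀ , a₁) (b₀ , b₁) → ≈-sym (≈-trans
      (reflexive (≡.trans (≡.sym (ℤ.pos-* (a₀ +ℕ 5 *ℕ a₁) (b₀ +ℕ 5 *ℕ b₁))) (cong +_ (product a₀ a₁ b₀ b₁))))
      -- The π² term 25 a₁ b₁, absent from `_⊠_`, vanishes modulo 25.
      (shiftℕ (a₀ *ℕ b₀ +ℕ 5 *ℕ (a₀ *ℕ b₁ +ℕ a₁ *ℕ b₀)) (a₁ *ℕ b₁)))
  ; ⟦1⟧            = ≈-refl
  ; expand         = λ x → let r = x ℤ.%ℕ 25 in
      r % 5 , r / 5 , m%n<n r 5 , m<n*o⇒m/o<n (ℤ.n%ℕd<d x 25) ,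
      ≈-trans (≈-%ℕ x) (reflexive (cong +_ (≡.trans (m≡m%n+[m/n]*n r 5) (cong (r % 5 +ℕ_) (ℕ.*-comm (r / 5) 5)))))
  ; zeroᵇ          = λ (a₀ , a₁) → (a₀ +ℕ 5 *ℕ a₁) % 25 ≡ᵇ 0
  ; zeroᵇ-sound    = λ (a₀ , a₁) → %≡0⇒≈0 (a₀ +ℕ 5 *ℕ a₁)
  ; zeroᵇ-complete = λ (a₀ , a₁) → ≈0⇒%≡0 (a₀ +ℕ 5 *ℕ a₁)
  ; 25≈0           = _
  ; π*digit≉0      = λ { {0} _ () ; {1} _ () ; {2} _ () ; {3} _ ()
                       ; {suc (suc (suc (suc _)))} (s≤s (s≤s (s≤s (s≤s (s≤s ()))))) }
  ; local          = _
  }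
  where
  open CommutativeRing ℤ₂₅ using (reflexive) renaming (refl to ≈-refl; sym to ≈-sym; trans to ≈-trans)
  open Residues 25

  ⟦_⟧ : Code → ℤ
  ⟦ a₀ , a₁ ⟧ = + (a₀ +ℕ 5 *ℕ a₁)

  sum : ∀ a₀ a₁ b₀ b₁ → (a₀ +ℕ b₀) +ℕ 5 *ℕ (a₁ +ℕ b₁) ≡ (a₀ +ℕ 5 *ℕ a₁) +ℕ (b₀ +ℕ 5 *ℕ b₁)
  sum = ℕ-Solver.solve-∀

  product : ∀ a₀ a₁ b₀ b₁ → (a₀ +ℕ 5 *ℕ a₁) *ℕ (b₀ +ℕ 5 *ℕ b₁) ≡
            a₀ *ℕ b₀ +ℕ 5 *ℕ (a₀ *ℕ b₁ +ℕ a₁ *ℕ b₀) +ℕ a₁ *ℕ b₁ *ℕ 25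
  product = ℕ-Solver.solve-∀

-- Polynomials modulo X² and the coding of 𝕊₅

module Truncation where
  open CommutativeRing 𝔽₅ using (_≈_; _+_; -_; 0#; +-group; zeroˡ; *-identityˡ; +-identityˡ; +-identityʳ; +-cong; +-congˡ; +-congʳ)
    renaming (refl to ≈-refl; sym to ≈-sym; trans to ≈-trans)
  open GroupProperties +-group using (x∙y⁻¹≈ε⇒x≈y; x≈y⇒x∙y⁻¹≈ε)
  open Polynomial 𝔽₅
  open CommutativeRing polynomialRing using () renaming (*-comm to ⊛-comm)
  open CommutativeRing 𝕊₅ using () renaming (_≈_ to _≈ₛ_)

  -- `X ⊛ X` evaluates to the coefficients 0, 0, 1; `lead` removes the summand `0# · p` that each
  -- leading zero contributes.
  X²⊛ : ∀ p → (X ⊛ X) ⊛ p ≋ 0# ∷ 0# ∷ p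
  X²⊛ p = coeffwise coeffs
    where
    lead : ∀ {q} n → coeff (0# · p ⊕ q) n ≈ coeff q n
    lead {q} n = ≈-trans (coeff-⊕ (0# · p) q n)
      (≈-trans (+-congʳ (≈-trans (coeff-· 0# p n) (zeroˡ (coeff p n)))) (+-identityˡ _))
    zeros : ∀ n → coeff (0# ∷ []) n ≈ 0#
    zeros zero    = ≈-refl
    zeros (suc n) = ≈-refl
    coeffs : ∀ n → coeff ((X ⊛ X) ⊛ p) n ≈ coeff (0# ∷ 0# ∷ p) n
    coeffs 0             = lead 0
    coeffs 1             = ≈-trans (lead 1) (lead 0)
    coeffs (suc (suc n)) = ≈-trans (lead (2 +ℕ n)) (≈-trans (lead (1 +ℕ n)) (≈-trans (coeff-⊕ (ℤ.1ℤ · p) (0# ∷ []) n)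
      (≈-trans (+-cong (≈-trans (coeff-· ℤ.1ℤ p n) (*-identityˡ _)) (zeros n)) (+-identityʳ _))))

  coeff-⊝ : ∀ p q n → coeff (p ⊕ ⊖ q) n ≈ coeff p n + - coeff q n
  coeff-⊝ p q n = ≈-trans (coeff-⊕ p (⊖ q) n) (+-congˡ {coeff p n} (coeff-⊖ q n))

  coeff-drop : ∀ p n → coeff (drop 2 p) n ≡ coeff p (2 +ℕ n)
  coeff-drop []          n = refl
  coeff-drop (a ∷ [])    n = refl
  coeff-drop (a ∷ b ∷ p) n = refl

  -- The difference has no constant or linear term, so dropping two coefficients divides it by X².
  ≈ₛ-intro : ∀ {p q} → coeff p 0 ≈ coeff q 0 → coeff p 1 ≈ coeff q 1 → p ≈ₛ q
  ≈ₛ-intro {p} {q} e₀ e₁ = congruent (drop 2 d , coeffwise λ n →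
    ≈-trans (coeff-≈ (⊛-comm (drop 2 d) (X ⊛ X)) n) (≈-trans (coeff-≈ (X²⊛ (drop 2 d)) n) (restore n)))
    where
    d = p ⊕ ⊖ q
    restore : ∀ n → coeff (0# ∷ 0# ∷ drop 2 d) n ≈ coeff d n
    restore 0             = ≈-sym (≈-trans (coeff-⊝ p q 0) (x≈y⇒x∙y⁻¹≈ε e₀))
    restore 1             = ≈-sym (≈-trans (coeff-⊝ p q 1) (x≈y⇒x∙y⁻¹≈ε e₁))
    restore (suc (suc n)) = CommutativeRing.reflexive 𝔽₅ (coeff-drop d n)

  ≈ₛ-elim : ∀ {p q} n → n < 2 → p ≈ₛ q → coeff p n ≈ coeff q n
  ≈ₛ-elim {p} {q} n n<2 (congruent (r , e)) = x∙y⁻¹≈ε⇒x≈y _ _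
    (≈-trans (≈-sym (coeff-⊝ p q n)) (≈-trans (≈-sym (coeff-≈ e n))
      (≈-trans (coeff-≈ (⊛-comm r (X ⊛ X)) n) (≈-trans (coeff-≈ (X²⊛ r) n) (low n n<2)))))
    where
    low : ∀ n → n < 2 → coeff (0# ∷ 0# ∷ r) n ≈ 0#
    low 0 _ = ≈-refl
    low 1 _ = ≈-refl
    low (suc (suc _)) (s≤s (s≤s ()))

𝕊₅-coding : Coding 𝕊₅
𝕊₅-coding = record
  { ⟦_⟧            = ⟦_⟧
  ; ⟦⟧-+           = λ a b → CommutativeRing.refl 𝕊₅
  ; ⟦⟧-*           = λ (a₀ , a₁) (b₀ , b₁) → ≈ₛ-intro
      (reflexive (≡.trans (ℤ.pos-* a₀ b₀) (≡.sym (ℤ.+-identityʳ _))))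
      (reflexive (cong₂ ℤ._+_ (ℤ.pos-* a₀ b₁) (≡.trans (ℤ.pos-* a₁ b₀) (≡.sym (ℤ.+-identityʳ _)))))
  ; ⟦1⟧            = ≈ₛ-intro ≈-refl ≈-refl
  ; expand         = λ p →
      coeff p 0 ℤ.%ℕ 5 , coeff p 1 ℤ.%ℕ 5 , ℤ.n%ℕd<d (coeff p 0) 5 , ℤ.n%ℕd<d (coeff p 1) 5 ,
      ≈ₛ-intro (≈-%ℕ (coeff p 0)) (≈-%ℕ (coeff p 1))
  ; zeroᵇ          = λ (a₀ , a₁) → (a₀ % 5 ≡ᵇ 0) ∧ (a₁ % 5 ≡ᵇ 0)
  ; zeroᵇ-sound    = λ (a₀ , a₁) h → ≈ₛ-intro
      (%≡0⇒≈0 a₀ (∧-proj₁ (a₀ % 5 ≡ᵇ 0) (a₁ % 5 ≡ᵇ 0) h))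
      (%≡0⇒≈0 a₁ (∧-proj₂ (a₀ % 5 ≡ᵇ 0) (a₁ % 5 ≡ᵇ 0) h))
  ; zeroᵇ-complete = λ (a₀ , a₁) e → ∧-intro (a₀ % 5 ≡ᵇ 0) (a₁ % 5 ≡ᵇ 0)
      (≈0⇒%≡0 a₀ (≈ₛ-elim 0 (s≤s z≤n) e)) (≈0⇒%≡0 a₁ (≈ₛ-elim 1 (s≤s (s≤s z≤n)) e))
  ; 25≈0           = _
  ; π*digit≉0      = λ { {0} _ () ; {1} _ () ; {2} _ () ; {3} _ ()
                       ; {suc (suc (suc (suc _)))} (s≤s (s≤s (s≤s (s≤s (s≤s ()))))) }
  ; local          = _
  }
  where
  open CommutativeRing 𝔽₅ using (reflexive) renaming (refl to ≈-refl)
  open Polynomial 𝔽₅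
  open Residues 5
  open Truncation

  ⟦_⟧ : Code → Poly
  ⟦ a₀ , a₁ ⟧ = + a₀ ∷ + a₁ ∷ []

-- Segment patterns and the three arcs

-- The part of an arc in a neighbour class whose points x₀ + s π, d + t π have
-- affine coordinates s and t.
data Pattern : Set where
  -- segments t = c for the listed c, which point to (1 : 0 : 0)
  radial : List ℕ → Pattern
  -- segments s = c + m t for the listed c
  sloped : ℕ → List ℕ → Pattern

-- c + m t may stay unreduced, since 5 π = 0 in both rings.
offsets : Pattern → List Code
offsets (radial cs)   = cartesianProduct digits cs
offsets (sloped m cs) = cartesianProductWith (λ c t → c +ℕ m *ℕ t , t) cs digits

-- The index d runs over the six lines through (1 : 0 : 0) modulo π, and x₀ over their five other
-- classes.
place : ℕ → ℕ → Code → Triple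
place 5 x₀ (s , t) = (x₀ , s) , 1ᶜ , (0 , t)
place d x₀ (s , t) = (x₀ , s) , (d , t) , 1ᶜ

-- Entry x₀ of row d describes the class of (x₀ : d : 1), or of (x₀ : 1 : 0) if d = 5.
arcPoints : List (List Pattern) → List Triple
arcPoints rows = concat (zipWith row (upTo 6) rows)
  where
  row : ℕ → List Pattern → List Triple
  row d ps = concat (zipWith (λ x₀ p → map (place d x₀) (offsets p)) digits ps)

-- Row 0 points to (1 : 1 : 1) and row 5 to (0 : 1 : 1), the two classes of row 1 with a single
-- segment.
blueprint₁₅ : List (List Pattern)
blueprint₁₅ =
    (sloped 1 (0 ∷ 1 ∷ 2 ∷ []) ∷ sloped 0 (0 ∷ 1 ∷ 2 ∷ []) ∷ sloped 4 (0 ∷ 1 ∷ 2 ∷ []) ∷ sloped 3 (0 ∷ 1 ∷ 2 ∷ []) ∷ sloped 2 (0 ∷ 1 ∷ 2 ∷ []) ∷ [])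
  ∷ (radial (0 ∷ []) ∷ radial (0 ∷ []) ∷ radial (1 ∷ 2 ∷ 3 ∷ []) ∷ radial (0 ∷ 1 ∷ 3 ∷ []) ∷ radial (1 ∷ 2 ∷ 3 ∷ []) ∷ [])
  ∷ (radial (0 ∷ 1 ∷ []) ∷ radial (0 ∷ 1 ∷ []) ∷ radial (0 ∷ 2 ∷ []) ∷ radial (1 ∷ 2 ∷ []) ∷ radial (2 ∷ 3 ∷ []) ∷ [])
  ∷ (radial (0 ∷ 1 ∷ []) ∷ radial (0 ∷ 1 ∷ []) ∷ radial (0 ∷ 2 ∷ []) ∷ radial (1 ∷ 2 ∷ []) ∷ radial (2 ∷ 3 ∷ []) ∷ [])
  ∷ (radial (0 ∷ 1 ∷ []) ∷ radial (0 ∷ 1 ∷ []) ∷ radial (0 ∷ 2 ∷ []) ∷ radial (1 ∷ 2 ∷ []) ∷ radial (2 ∷ 3 ∷ []) ∷ [])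
  ∷ (sloped 0 (0 ∷ 1 ∷ 2 ∷ []) ∷ sloped 4 (0 ∷ 1 ∷ 2 ∷ []) ∷ sloped 3 (0 ∷ 1 ∷ 2 ∷ []) ∷ sloped 2 (0 ∷ 1 ∷ 2 ∷ []) ∷ sloped 1 (0 ∷ 1 ∷ 2 ∷ []) ∷ [])
  ∷ []

-- There are 75 segments, 16 in each sloped row; a line over such a row meets each of its segments
-- once.
blueprint₁₆ : List (List Pattern)
blueprint₁₆ =
    (sloped 0 (0 ∷ 1 ∷ 2 ∷ []) ∷ sloped 3 (0 ∷ 1 ∷ 2 ∷ []) ∷ sloped 3 (0 ∷ 1 ∷ 2 ∷ []) ∷ sloped 4 (0 ∷ 1 ∷ 2 ∷ []) ∷ sloped 0 (0 ∷ 1 ∷ 2 ∷ 3 ∷ []) ∷ [])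
  ∷ (radial (0 ∷ []) ∷ radial (0 ∷ 1 ∷ 2 ∷ []) ∷ radial (1 ∷ 3 ∷ []) ∷ radial (1 ∷ 2 ∷ 3 ∷ []) ∷ radial (0 ∷ 2 ∷ []) ∷ [])
  ∷ (radial (0 ∷ 1 ∷ []) ∷ radial (0 ∷ 1 ∷ []) ∷ radial (2 ∷ 3 ∷ []) ∷ radial (1 ∷ 2 ∷ []) ∷ radial (0 ∷ 2 ∷ 3 ∷ []) ∷ [])
  ∷ (radial [] ∷ radial (0 ∷ 1 ∷ []) ∷ radial (0 ∷ 1 ∷ 2 ∷ []) ∷ radial (1 ∷ 2 ∷ 4 ∷ []) ∷ radial (0 ∷ 2 ∷ 4 ∷ []) ∷ [])
  ∷ (radial (0 ∷ 1 ∷ []) ∷ radial (0 ∷ 1 ∷ 2 ∷ []) ∷ radial (0 ∷ 1 ∷ 2 ∷ []) ∷ radial (2 ∷ 4 ∷ []) ∷ radial [] ∷ [])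
  ∷ (sloped 0 (0 ∷ 1 ∷ 2 ∷ []) ∷ sloped 0 (0 ∷ 1 ∷ 2 ∷ 3 ∷ []) ∷ sloped 1 (0 ∷ 1 ∷ 2 ∷ 3 ∷ []) ∷ sloped 1 (0 ∷ 1 ∷ []) ∷ sloped 3 (0 ∷ 1 ∷ 2 ∷ []) ∷ [])
  ∷ []

-- There are 79 segments; three rows are sloped, again with 16 segments each.
blueprint₁₇ : List (List Pattern)
blueprint₁₇ =
    (sloped 1 (0 ∷ 1 ∷ 2 ∷ 3 ∷ []) ∷ sloped 2 (0 ∷ 1 ∷ 2 ∷ []) ∷ sloped 2 (0 ∷ 1 ∷ 2 ∷ 3 ∷ []) ∷ sloped 4 (0 ∷ 1 ∷ 2 ∷ []) ∷ sloped 1 (0 ∷ 1 ∷ []) ∷ [])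
  ∷ (sloped 1 (0 ∷ 1 ∷ []) ∷ sloped 3 (0 ∷ 1 ∷ 2 ∷ 3 ∷ []) ∷ sloped 4 (0 ∷ 1 ∷ 2 ∷ []) ∷ sloped 2 (0 ∷ 1 ∷ 2 ∷ []) ∷ sloped 0 (0 ∷ 1 ∷ 2 ∷ 3 ∷ []) ∷ [])
  ∷ (radial (0 ∷ 1 ∷ []) ∷ radial [] ∷ radial (0 ∷ 1 ∷ 2 ∷ []) ∷ radial (1 ∷ 2 ∷ 3 ∷ []) ∷ radial (0 ∷ 2 ∷ 3 ∷ []) ∷ [])
  ∷ (radial (0 ∷ 1 ∷ []) ∷ radial (0 ∷ 1 ∷ 2 ∷ []) ∷ radial [] ∷ radial (0 ∷ 2 ∷ 4 ∷ []) ∷ radial (1 ∷ 2 ∷ 3 ∷ []) ∷ [])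
  ∷ (radial (0 ∷ 1 ∷ []) ∷ radial (0 ∷ 1 ∷ 2 ∷ []) ∷ radial (0 ∷ 1 ∷ 2 ∷ []) ∷ radial (2 ∷ []) ∷ radial [] ∷ [])
  ∷ (sloped 0 (0 ∷ 1 ∷ 2 ∷ 3 ∷ []) ∷ sloped 4 (0 ∷ 1 ∷ []) ∷ sloped 1 (0 ∷ 1 ∷ 2 ∷ []) ∷ sloped 2 (0 ∷ 1 ∷ 2 ∷ 3 ∷ []) ∷ sloped 3 (0 ∷ 1 ∷ 2 ∷ []) ∷ [])
  ∷ []

ℤ₂₅-arc₁₅ : ProjectiveArc (PHG₂ (CommutativeRing.ring ℤ₂₅)) 355 15
-- The three tests are closed terms that evaluate to `true`, and the length of the list evaluates to
-- 355.
ℤ₂₅-arc₁₅ = Arcs.projectiveArc ℤ₂₅ ℤ₂₅-coding 15 (arcPoints blueprint₁₅) _ _ _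

ℤ₂₅-arc₁₆ : ProjectiveArc (PHG₂ (CommutativeRing.ring ℤ₂₅)) 375 16
ℤ₂₅-arc₁₆ = Arcs.projectiveArc ℤ₂₅ ℤ₂₅-coding 16 (arcPoints blueprint₁₆) _ _ _

ℤ₂₅-arc₁₇ : ProjectiveArc (PHG₂ (CommutativeRing.ring ℤ₂₅)) 395 17
ℤ₂₅-arc₁₇ = Arcs.projectiveArc ℤ₂₅ ℤ₂₅-coding 17 (arcPoints blueprint₁₇) _ _ _

𝕊₅-arc₁₅ : ProjectiveArc (PHG₂ (CommutativeRing.ring 𝕊₅)) 355 15
𝕊₅-arc₁₅ = Arcs.projectiveArc 𝕊₅ 𝕊₅-coding 15 (arcPoints blueprint₁₅) _ _ _

𝕊₅-arc₁₆ : ProjectiveArc (PHG₂ (CommutativeRing.ring 𝕊₅)) 375 16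
𝕊₅-arc₁₆ = Arcs.projectiveArc 𝕊₅ 𝕊₅-coding 16 (arcPoints blueprint₁₆) _ _ _

𝕊₅-arc₁₇ : ProjectiveArc (PHG₂ (CommutativeRing.ring 𝕊₅)) 395 17
𝕊₅-arc₁₇ = Arcs.projectiveArc 𝕊₅ 𝕊₅-coding 17 (arcPoints blueprint₁₇) _ _ _

theorem3p9 : (ProjectiveArc (PHG₂ (CommutativeRing.ring ℤ₂₅)) 355 15
              × ProjectiveArc (PHG₂ (CommutativeRing.ring ℤ₂₅)) 375 16
              × ProjectiveArc (PHG₂ (CommutativeRing.ring ℤ₂₅)) 395 17)
           × (ProjectiveArc (PHG₂ (CommutativeRing.ring 𝕊₅)) 355 15
              × ProjectiveArc (PHG₂ (CommutativeRing.ring 𝕊₅)) 375 16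
              × ProjectiveArc (PHG₂ (CommutativeRing.ring 𝕊₅)) 395 17)
theorem3p9 = (ℤ₂₅-arc₁₅ , ℤ₂₅-arc₁₆ , ℤ₂₅-arc₁₇) , (𝕊₅-arc₁₅ , 𝕊₅-arc₁₆ , 𝕊₅-arc₁₇)
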